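{- If $\kappa$ is a Mahlo cardinal, then for every meta-ordinal term $t$ having only ordinals less than $\kappa$, the cardinal $\kappa$ is $t$-inaccessible.
   Context: A cardinal is inaccessible if it is an uncountable regular strong limit cardinal. An infinite cardinal $\kappa$ is Mahlo if and only if the set of inaccessible cardinals below $\kappa$ is stationary in $\kappa$. Meta-ordinal terms: $\Omega$ is a formal symbol (standing for the order type of Ord). A meta-ordinal term is a formal finite expression $t=\Omega^{\alpha}\cdot\beta+\Omega^{\eta}\cdot\gamma+\dots+\Omega\cdot\delta+\sigma$ with exponents $\alpha>\eta>\dots$ strictly decreasing ordinals and coefficients $\beta,\gamma,\dots,\delta,\sigma$ ordinals. Terms are ordered lexicographically as in Cantor normal form: first compare the highest powers of $\Omega$; if equal, compare their coefficients; if equal, compare the next highest powers of $\Omega$, and so on. "The ordinals of $t$" are the exponents and coefficients occurring in $t$. Definition (by recursion): if $t$ is a meta-ordinal term with ordinals less than $\kappa$, then a cardinal $\kappa$ is $t$-inaccessible if and only if $\kappa$ is inaccessible and for every meta-ordinal term $s<t$ having ordinals less than $\kappa$, the cardinal $\kappa$ is a limit of $s$-inaccessible cardinals. -}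

module Defs where

open import Level using (Level) renaming (suc to lsuc)
open import Data.Empty using (⊥)
open import Data.Product using (∃; ∃!; _×_; _,_; proj₁; proj₂)
open import Data.Product.Relation.Binary.Lex.Strict using (×-Lex)
open import Data.Sum using (_⊎_)
open import Data.List using (List)
open import Data.List.Relation.Unary.All using (All)
open import Data.List.Relation.Unary.Linked using (Linked)
open import Data.List.Relation.Binary.Lex.Strict using (Lex-<)
open import Function.Bundles using (_⇔_)
open import Relation.Binary.PropositionalEquality using (_≡_; _≢_)
open import Relation.Nullary using (¬_)

-- A universe of sets satisfying the ZFC axioms.  The axiom schemas range over
-- all properties in `Set ℓ`, which is also where every formula quantifying over
-- V lives.  The logic is made classical by assuming `ExcludedMiddle ℓ` where
-- results are stated.

record ZFC (ℓ : Level) : Set (lsuc ℓ) where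
  infix 4 _∈_ _⊆_
  field
    V   : Set ℓ
    _∈_ : V → V → Set ℓ

  _⊆_ : V → V → Set ℓ
  x ⊆ y = ∀ z → z ∈ x → z ∈ y

  field
    extensionality : ∀ x y → (∀ z → z ∈ x ⇔ z ∈ y) → x ≡ y
    foundation : ∀ x → (∃ λ y → y ∈ x) →
      ∃ λ y → y ∈ x × (∀ z → z ∈ y → ¬ (z ∈ x))
    pairing : ∀ x y → ∃ λ p → ∀ z → z ∈ p ⇔ (z ≡ x ⊎ z ≡ y)
    union : ∀ x → ∃ λ u → ∀ z → z ∈ u ⇔ (∃ λ y → y ∈ x × z ∈ y)
    powerset : ∀ x → ∃ λ p → ∀ z → z ∈ p ⇔ z ⊆ x
    infinity : ∃ λ w →
      (∃ λ e → e ∈ w × (∀ z → ¬ (z ∈ e))) ×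
      (∀ x → x ∈ w → ∃ λ s → s ∈ w × (∀ z → z ∈ s ⇔ (z ∈ x ⊎ z ≡ x)))
    separation : ∀ (P : V → Set ℓ) x → ∃ λ y → ∀ z → z ∈ y ⇔ (z ∈ x × P z)
    replacement : ∀ (R : V → V → Set ℓ) a →
      (∀ x y z → x ∈ a → R x y → R x z → y ≡ z) →
      ∃ λ b → ∀ y → y ∈ b ⇔ (∃ λ x → x ∈ a × R x y)
    choice : ∀ x →
      (∀ y → y ∈ x → ∃ λ z → z ∈ y) →
      (∀ y y′ z → y ∈ x → y′ ∈ x → z ∈ y → z ∈ y′ → y ≡ y′) →
      ∃ λ c → ∀ y → y ∈ x → ∃! _≡_ λ z → z ∈ c × z ∈ y

module SetTheory {ℓ : Level} (𝕍 : ZFC ℓ) where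
  open ZFC 𝕍 public

  infixr 30 _∪_
  infix 4 _≤_ _≈_ _≺_ _Below_ _-inaccessible_

  sep : (V → Set ℓ) → V → V
  sep P x = proj₁ (separation P x)

  ∅ : V
  ∅ = sep (λ x → ¬ (x ≡ x)) (proj₁ infinity)

  pair : V → V → V
  pair x y = proj₁ (pairing x y)

  ⋃ : V → V
  ⋃ x = proj₁ (union x)

  _∪_ : V → V → V
  x ∪ y = ⋃ (pair x y)

  𝒫 : V → V
  𝒫 x = proj₁ (powerset x)

  succ : V → V
  succ x = x ∪ pair x x

  Inductive : V → Set ℓ
  Inductive i = ∅ ∈ i × (∀ x → x ∈ i → succ x ∈ i)

  ω : V
  ω = sep (λ n → ∀ i → Inductive i → n ∈ i) (proj₁ infinity)

  ⟨_,_⟩ : V → V → V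
  ⟨ x , y ⟩ = pair (pair x x) (pair x y)

  record IsFunction (f a b : V) : Set ℓ where
    field
      graph : ∀ p → p ∈ f →
        ∃ λ x → ∃ λ y → x ∈ a × y ∈ b × p ≡ ⟨ x , y ⟩
      total : ∀ x → x ∈ a → ∃! _≡_ λ y → ⟨ x , y ⟩ ∈ f

  record IsBijection (f a b : V) : Set ℓ where
    field
      function   : IsFunction f a b
      injective  : ∀ x x′ y → ⟨ x , y ⟩ ∈ f → ⟨ x′ , y ⟩ ∈ f → x ≡ x′
      surjective : ∀ y → y ∈ b → ∃ λ x → ⟨ x , y ⟩ ∈ f

  _≈_ : V → V → Set ℓ
  a ≈ b = ∃ λ f → IsBijection f a b

  -- Von Neumann ordinals: transitive sets strictly well-ordered by ∈.

  record IsOrdinal (α : V) : Set ℓ where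
    field
      transitive    : ∀ x → x ∈ α → x ⊆ α
      ∈-irreflexive : ∀ x → x ∈ α → ¬ (x ∈ x)
      ∈-transitive  : ∀ x y z → x ∈ α → y ∈ α → z ∈ α → x ∈ y → y ∈ z → x ∈ z
      ∈-compare     : ∀ x y → x ∈ α → y ∈ α → x ∈ y ⊎ x ≡ y ⊎ y ∈ x
      ∈-least       : ∀ s → s ⊆ α → (∃ λ x → x ∈ s) →
                      ∃ λ m → m ∈ s × (∀ x → x ∈ s → m ≡ x ⊎ m ∈ x)

  _≤_ : V → V → Set ℓ
  α ≤ β = α ∈ β ⊎ α ≡ β

  IsCardinal : V → Set ℓ
  IsCardinal κ = IsOrdinal κ × (∀ α → α ∈ κ → ¬ (α ≈ κ))

  IsInfiniteCardinal : V → Set ℓ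
  IsInfiniteCardinal κ = IsCardinal κ × ω ≤ κ

  -- The range of f is cofinal in κ.
  Cofinal : V → V → Set ℓ
  Cofinal f κ = ∀ β → β ∈ κ → ∃ λ ξ → ∃ λ η → ⟨ ξ , η ⟩ ∈ f × β ≤ η

  Regular : V → Set ℓ
  Regular κ = IsInfiniteCardinal κ ×
    (∀ α f → α ∈ κ → IsFunction f α κ → ¬ Cofinal f κ)

  -- 2^μ is the cardinal ν equinumerous with the power set of μ.
  StrongLimit : V → Set ℓ
  StrongLimit κ = ∀ μ → μ ∈ κ → IsCardinal μ →
    ∃ λ ν → ν ∈ κ × IsCardinal ν × ν ≈ 𝒫 μ

  Inaccessible : V → Set ℓ
  Inaccessible κ = ω ∈ κ × Regular κ × StrongLimit κ

  LimitOf : (V → Set ℓ) → V → Set ℓ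
  LimitOf P κ = ∀ β → β ∈ κ → ∃ λ γ → γ ∈ κ × β ∈ γ × P γ

  Unbounded : V → V → Set ℓ
  Unbounded c κ = LimitOf (_∈ c) κ

  -- As `Unbounded` is strict, a nonempty α in which c is unbounded is a limit
  -- ordinal.
  Closed : V → V → Set ℓ
  Closed c κ = ∀ α → α ∈ κ → α ≢ ∅ → Unbounded c α → α ∈ c

  Club : V → V → Set ℓ
  Club c κ = c ⊆ κ × Closed c κ × Unbounded c κ

  Stationary : V → V → Set ℓ
  Stationary s κ = s ⊆ κ × (∀ c → Club c κ → ∃ λ γ → γ ∈ s × γ ∈ c)

  Mahlo : V → Set ℓ
  Mahlo κ = IsInfiniteCardinal κ × Stationary (sep Inaccessible κ) κ

  -- The entry (α , β) stands for the summand Ω^α·β.  As in Cantor normal form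
  -- only nonzero summands are listed; the summand σ has exponent ∅, and the
  -- empty list is the term 0.

  record MetaOrdinal : Set ℓ where
    field
      summands   : List (V × V)
      ordinals   : All (λ (α , β) → IsOrdinal α × IsOrdinal β) summands
      nonzero    : All (λ (α , β) → β ≢ ∅) summands
      decreasing : Linked (λ (α , _) (η , _) → η ∈ α) summands

  open MetaOrdinal public

  _≺_ : MetaOrdinal → MetaOrdinal → Set ℓ
  s ≺ t = Lex-< _≡_ (×-Lex _≡_ _∈_ _∈_) (summands s) (summands t)

  _Below_ : MetaOrdinal → V → Set ℓ
  t Below κ = All (λ (α , β) → α ∈ κ × β ∈ κ) (summands t)

  -- The recursion is expressed as an inductive predicate; it descends along
  -- both ≺ and ∈, so the defining equivalence has no other solution.

  data _-inaccessible_ (t : MetaOrdinal) (κ : V) : Set ℓ where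
    inaccessible :
      t Below κ →
      Inaccessible κ →
      (∀ s → s ≺ t → s Below κ → LimitOf (s -inaccessible_) κ) →
      t -inaccessible κ

{-# OPTIONS --safe #-}

-- The regularity of κ and its being a limit of s-inaccessible cardinals are both
-- obtained by exhibiting a club of γ < κ and evaluating it at an inaccessible γ.  If f : α → κ were
-- cofinal, the γ > α in which the range of f is cofinal would form a club, and
-- no regular γ lies in it.  Given that κ is regular, argue by induction on s
-- along ≺: the γ < κ which are limits of s′-inaccessible cardinals for every
-- s′ ≺ s with ordinals below γ are closure points of finitary operations on κ,
-- hence form a club, and the inaccessible ones among them are s-inaccessible.

module Submission where

open import Defs
open import Axiom.ExcludedMiddle using (ExcludedMiddle)
open import Data.Empty using (⊥-elim)
open import Data.List using (List; []; _∷_; length)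
open import Data.List.Properties using (∷-injective)
open import Data.List.Relation.Binary.Lex.Core using (base; this; next)
open import Data.List.Relation.Binary.Lex.Strict using (Lex-<)
open import Data.List.Relation.Unary.All as All using (All; []; _∷_)
open import Data.List.Relation.Unary.Linked as Linked using (Linked; _∷_)
open import Data.Nat using (ℕ; zero; suc)
open import Data.Nat.Properties using (suc-injective)
open import Data.Product using (∃; ∃!; _×_; _,_; proj₁; proj₂)
open import Data.Product.Relation.Binary.Lex.Strict using (×-Lex)
open import Data.Sum using (_⊎_; inj₁; inj₂)
open import Function.Base using (_∘_; id)
open import Function.Bundles using (Equivalence; mk⇔)
open import Induction.WellFounded using (Acc; acc)
open import Relation.Binary.PropositionalEquality using (_≡_; _≢_; refl; sym; trans; subst; cong)
open import Relation.Nullary using (¬_; Dec; yes; no)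
open import Relation.Nullary.Decidable using (decidable-stable)

open Equivalence using (to; from)

module _ {ℓ} (em : ExcludedMiddle ℓ) (𝕍 : ZFC ℓ) where
  open SetTheory 𝕍

  -- Sets

  module _ {P : V → Set ℓ} {x z : V} where
    ∈-sep⁺ : z ∈ x → P z → z ∈ sep P x
    ∈-sep⁺ z∈x Pz = from (proj₂ (separation P x) z) (z∈x , Pz)

    ∈-sep⁻ : z ∈ sep P x → z ∈ x × P z
    ∈-sep⁻ = to (proj₂ (separation P x) z)

  ∈-pair⁻ : ∀ {x y z} → z ∈ pair x y → z ≡ x ⊎ z ≡ y
  ∈-pair⁻ {x} {y} {z} = to (proj₂ (pairing x y) z)

  ∈-pairˡ : ∀ {x y} → x ∈ pair x y
  ∈-pairˡ {x} {y} = from (proj₂ (pairing x y) x) (inj₁ refl)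

  ∈-pairʳ : ∀ {x y} → y ∈ pair x y
  ∈-pairʳ {x} {y} = from (proj₂ (pairing x y) y) (inj₂ refl)

  ∉∅ : ∀ {x} → ¬ (x ∈ ∅)
  ∉∅ x∈∅ = proj₂ (∈-sep⁻ x∈∅) refl

  empty≡∅ : ∀ {x} → (∀ z → ¬ (z ∈ x)) → x ≡ ∅
  empty≡∅ e = extensionality _ _ λ z → mk⇔ (⊥-elim ∘ e z) (⊥-elim ∘ ∉∅)

  ≢∅⇒nonempty : ∀ {x} → x ≢ ∅ → ∃ λ z → z ∈ x
  ≢∅⇒nonempty x≢∅ = decidable-stable em λ e → x≢∅ (empty≡∅ λ z z∈x → e (z , z∈x))

  ∈-irrefl : ∀ {x} → ¬ (x ∈ x)
  ∈-irrefl {x} x∈x with foundation (pair x x) (x , ∈-pairˡ)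
  ... | y , y∈ , disjoint with ∈-pair⁻ y∈
  ... | inj₁ refl = disjoint x x∈x ∈-pairˡ
  ... | inj₂ refl = disjoint x x∈x ∈-pairˡ

  ∈-asym : ∀ {x y} → x ∈ y → ¬ (y ∈ x)
  ∈-asym {x} {y} x∈y y∈x with foundation (pair x y) (x , ∈-pairˡ)
  ... | z , z∈ , disjoint with ∈-pair⁻ z∈
  ... | inj₁ refl = disjoint y y∈x ∈-pairʳ
  ... | inj₂ refl = disjoint x x∈y ∈-pairˡ

  ≤⇒∌ : ∀ {x y} → x ≤ y → ¬ (y ∈ x)
  ≤⇒∌ (inj₁ x∈y)  = ∈-asym x∈y
  ≤⇒∌ (inj₂ refl) = ∈-irrefl

  ∈-succ⁻ : ∀ {x z} → z ∈ succ x → z ≤ x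
  ∈-succ⁻ {x} {z} z∈ with to (proj₂ (union (pair x (pair x x))) z) z∈
  ... | y , y∈ , z∈y with ∈-pair⁻ y∈
  ... | inj₁ refl = inj₁ z∈y
  ... | inj₂ refl with ∈-pair⁻ z∈y
  ... | inj₁ z≡x = inj₂ z≡x
  ... | inj₂ z≡x = inj₂ z≡x

  ∈-succ⁺ : ∀ {x z} → z ≤ x → z ∈ succ x
  ∈-succ⁺ {x} {z} (inj₁ z∈x)  = from (proj₂ (union (pair x (pair x x))) z) (x , ∈-pairˡ , z∈x)
  ∈-succ⁺ {x} {z} (inj₂ refl) = from (proj₂ (union (pair x (pair x x))) z) (pair x x , ∈-pairʳ , ∈-pairˡ)

  ∈-succ : ∀ {x} → x ∈ succ x
  ∈-succ = ∈-succ⁺ (inj₂ refl)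

  succ≢∅ : ∀ {x} → succ x ≢ ∅
  succ≢∅ eq = ∉∅ (subst (_ ∈_) eq ∈-succ)

  succ-injective : ∀ {x y} → succ x ≡ succ y → x ≡ y
  succ-injective {x} {y} eq with ∈-succ⁻ (subst (x ∈_) eq ∈-succ) | ∈-succ⁻ (subst (y ∈_) (sym eq) ∈-succ)
  ... | inj₂ x≡y | _         = x≡y
  ... | inj₁ x∈y | inj₂ y≡x = sym y≡x
  ... | inj₁ x∈y | inj₁ y∈x = ⊥-elim (∈-asym x∈y y∈x)

  ⟨,⟩-injectiveˡ : ∀ {x y x′ y′} → ⟨ x , y ⟩ ≡ ⟨ x′ , y′ ⟩ → x ≡ x′
  ⟨,⟩-injectiveˡ {x} {y} {x′} eq with ∈-pair⁻ (subst (pair x x ∈_) eq ∈-pairˡ)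
  ... | inj₁ p with ∈-pair⁻ (subst (x′ ∈_) (sym p) ∈-pairˡ)
  ...   | inj₁ q = sym q
  ...   | inj₂ q = sym q
  ⟨,⟩-injectiveˡ {x} {y} {x′} eq | inj₂ p with ∈-pair⁻ (subst (x′ ∈_) (sym p) ∈-pairˡ)
  ...   | inj₁ q = sym q
  ...   | inj₂ q = sym q

  -- A Kuratowski pair with equal components collapses, so one direction gives only this
  -- alternative. `⟨,⟩-injectiveʳ` uses both directions: if neither yields `y ≡ y′`, both components
  -- equal `x`.
  ⟨,⟩-injectiveʳ′ : ∀ {x y y′} → ⟨ x , y ⟩ ≡ ⟨ x , y′ ⟩ → y ≡ x ⊎ y ≡ y′
  ⟨,⟩-injectiveʳ′ {x} {y} eq with ∈-pair⁻ (subst (pair x y ∈_) eq ∈-pairʳ)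
  ... | inj₂ p = ∈-pair⁻ (subst (y ∈_) p ∈-pairʳ)
  ... | inj₁ p with ∈-pair⁻ (subst (y ∈_) p ∈-pairʳ)
  ...   | inj₁ q = inj₁ q
  ...   | inj₂ q = inj₁ q

  ⟨,⟩-injectiveʳ : ∀ {x y x′ y′} → ⟨ x , y ⟩ ≡ ⟨ x′ , y′ ⟩ → y ≡ y′
  ⟨,⟩-injectiveʳ eq with ⟨,⟩-injectiveˡ eq
  ... | refl with ⟨,⟩-injectiveʳ′ eq | ⟨,⟩-injectiveʳ′ (sym eq)
  ...   | inj₂ p | _      = p
  ...   | inj₁ p | inj₁ q = trans p (sym q)
  ...   | inj₁ p | inj₂ q = sym q

  -- Functions obtained by replacement

  module _ (G : V → V → Set ℓ) {a b : V}
           (total : ∀ {x} → x ∈ a → ∃! _≡_ λ y → y ∈ b × G x y) where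

    private
      -- The condition `y ∈ b` is part of the replaced relation because `G` is assumed single-valued
      -- only within `b`.
      replaced = replacement (λ x p → ∃ λ y → (y ∈ b × G x y) × p ≡ ⟨ x , y ⟩) a
        λ x p q x∈a (y , Gxy , p≡) (z , Gxz , q≡) →
          let (_ , _ , unique) = total x∈a in
          trans p≡ (trans (cong ⟨ x ,_⟩ (trans (sym (unique Gxy)) (unique Gxz))) (sym q≡))

    graph : V
    graph = proj₁ replaced

    ∈-graph⁺ : ∀ {x y} → x ∈ a → y ∈ b → G x y → ⟨ x , y ⟩ ∈ graph
    ∈-graph⁺ x∈a y∈b Gxy = from (proj₂ replaced _) (_ , x∈a , _ , (y∈b , Gxy) , refl)

    ∈-graph⁻ : ∀ {x y} → ⟨ x , y ⟩ ∈ graph → x ∈ a × y ∈ b × G x y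
    ∈-graph⁻ p with to (proj₂ replaced _) p
    ... | x , x∈a , y , (y∈b , Gxy) , eq with ⟨,⟩-injectiveˡ eq | ⟨,⟩-injectiveʳ eq
    ... | refl | refl = x∈a , y∈b , Gxy

    graph-isFunction : IsFunction graph a b
    graph-isFunction = record
      { graph = λ p p∈ →
          let (x , x∈a , y , (y∈b , _) , eq) = to (proj₂ replaced p) p∈ in
          x , y , x∈a , y∈b , eq
      ; total = λ x x∈a →
          let (y , (y∈b , Gxy) , unique) = total x∈a in
          y , ∈-graph⁺ x∈a y∈b Gxy , unique ∘ proj₂ ∘ ∈-graph⁻
      }

  -- Natural numbers

  ∅∈ω : ∅ ∈ ω
  ∅∈ω = let (e , e∈ , e-empty) = proj₁ (proj₂ infinity) in
    ∈-sep⁺ (subst (_∈ proj₁ infinity) (empty≡∅ e-empty) e∈) λ _ → proj₁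

  succ∈ω : ∀ {x} → x ∈ ω → succ x ∈ ω
  succ∈ω {x} x∈ω =
    let (x∈w , x∈ind) = ∈-sep⁻ x∈ω
        (s , s∈w , s-spec) = proj₂ (proj₂ infinity) x x∈w
        s≡succ = extensionality s (succ x) λ z → mk⇔
          (∈-succ⁺ ∘ to (s-spec z)) (from (s-spec z) ∘ ∈-succ⁻)
    in ∈-sep⁺ (subst (_∈ _) s≡succ s∈w) λ i ind → proj₂ ind x (x∈ind i ind)

  numeral : ℕ → V
  numeral zero    = ∅
  numeral (suc n) = succ (numeral n)

  numeral∈ω : ∀ n → numeral n ∈ ω
  numeral∈ω zero    = ∅∈ω
  numeral∈ω (suc n) = succ∈ω (numeral∈ω n)

  -- The numerals in `ω` form an inductive set, and `ω` is contained in every inductive set. Case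
  -- analysis on elements of `ω` thereby reduces to `ℕ`.
  ω⊆numerals : ∀ {x} → x ∈ ω → ∃ λ n → x ≡ numeral n
  ω⊆numerals {x} x∈ω = proj₂ (∈-sep⁻ (proj₂ (∈-sep⁻ x∈ω) (sep IsNumeral ω) closed))
    where
    IsNumeral : V → Set ℓ
    IsNumeral y = ∃ λ n → y ≡ numeral n

    closed : Inductive (sep IsNumeral ω)
    closed = ∈-sep⁺ ∅∈ω (0 , refl) , λ y y∈ →
      let (y∈ω , n , y≡) = ∈-sep⁻ y∈ in ∈-sep⁺ (succ∈ω y∈ω) (suc n , cong succ y≡)

  numeral-injective : ∀ m n → numeral m ≡ numeral n → m ≡ n
  numeral-injective zero    zero    eq = refl
  numeral-injective zero    (suc n) eq = ⊥-elim (succ≢∅ (sym eq))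
  numeral-injective (suc m) zero    eq = ⊥-elim (succ≢∅ eq)
  numeral-injective (suc m) (suc n) eq = cong suc (numeral-injective m n (succ-injective eq))

  -- Ordinals

  module _ {κ : V} (ord : IsOrdinal κ) where
    open IsOrdinal ord

    ∈-trans : ∀ {x y} → x ∈ y → y ∈ κ → x ∈ κ
    ∈-trans {x} {y} x∈y y∈κ = transitive y y∈κ x x∈y

    ∈-isOrdinal : ∀ {α} → α ∈ κ → IsOrdinal α
    ∈-isOrdinal {α} α∈κ = record
      { transitive    = λ x x∈α y y∈x →
          ∈-transitive y x α (∈-trans y∈x (α⊆κ x x∈α)) (α⊆κ x x∈α) α∈κ y∈x x∈α
      ; ∈-irreflexive = λ x x∈α → ∈-irreflexive x (α⊆κ x x∈α)
      ; ∈-transitive  = λ x y z x∈α y∈α z∈α →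
          ∈-transitive x y z (α⊆κ x x∈α) (α⊆κ y y∈α) (α⊆κ z z∈α)
      ; ∈-compare     = λ x y x∈α y∈α → ∈-compare x y (α⊆κ x x∈α) (α⊆κ y y∈α)
      ; ∈-least       = λ s s⊆α → ∈-least s (λ x → α⊆κ x ∘ s⊆α x)
      }
      where
      α⊆κ : α ⊆ κ
      α⊆κ = transitive α α∈κ

    ≤-∈-trans : ∀ {x y z} → x ≤ y → y ∈ z → z ∈ κ → x ∈ z
    ≤-∈-trans (inj₂ refl) y∈z z∈κ = y∈z
    ≤-∈-trans (inj₁ x∈y)  y∈z z∈κ = IsOrdinal.transitive (∈-isOrdinal z∈κ) _ y∈z _ x∈y

    ≰⇒∋ : ∀ {x y} → x ∈ κ → y ∈ κ → ¬ (x ≤ y) → y ∈ x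
    ≰⇒∋ {x} {y} x∈κ y∈κ x≰y with ∈-compare x y x∈κ y∈κ
    ... | inj₁ x∈y        = ⊥-elim (x≰y (inj₁ x∈y))
    ... | inj₂ (inj₁ x≡y) = ⊥-elim (x≰y (inj₂ x≡y))
    ... | inj₂ (inj₂ y∈x) = y∈x

    ∉⇒≥ : ∀ {x y} → x ∈ κ → y ∈ κ → ¬ (x ∈ y) → y ≤ x
    ∉⇒≥ {x} {y} x∈κ y∈κ x∉y with ∈-compare x y x∈κ y∈κ
    ... | inj₁ x∈y        = ⊥-elim (x∉y x∈y)
    ... | inj₂ (inj₁ x≡y) = inj₂ (sym x≡y)
    ... | inj₂ (inj₂ y∈x) = inj₁ y∈x

    opaque
      least : (P : V → Set ℓ) → (∃ λ x → x ∈ κ × P x) →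
              ∃ λ m → m ∈ κ × P m × (∀ {x} → x ∈ κ → P x → m ≤ x)
      least P (x , x∈κ , Px) =
        let (m , m∈ , m-least) = ∈-least (sep P κ) (λ _ → proj₁ ∘ ∈-sep⁻) (x , ∈-sep⁺ x∈κ Px)
            (m∈κ , Pm) = ∈-sep⁻ m∈
        in m , m∈κ , Pm , λ {z} z∈κ Pz → swap (m-least z (∈-sep⁺ z∈κ Pz))
        where
        swap : ∀ {m z} → m ≡ z ⊎ m ∈ z → m ≤ z
        swap (inj₁ m≡z) = inj₂ m≡z
        swap (inj₂ m∈z) = inj₁ m∈z

    -- The least element of `κ` containing `β` must be `succ β`: by minimality none of its members
    -- contains `β`.
    ∈⇒succ∈ : ∀ {β x} → β ∈ x → x ∈ κ → succ β ∈ κ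
    ∈⇒succ∈ {β} {x} β∈x x∈κ with least (β ∈_) (x , x∈κ , β∈x)
    ... | m , m∈κ , β∈m , m-least = subst (_∈ κ) m≡succ m∈κ
      where
      below : ∀ {y} → y ∈ m → y ≤ β
      below y∈m = ∉⇒≥ (∈-trans β∈x x∈κ) (∈-trans y∈m m∈κ) λ β∈y →
        ≤⇒∌ (m-least (∈-trans y∈m m∈κ) β∈y) y∈m

      m≡succ : m ≡ succ β
      m≡succ = extensionality _ _ λ y → mk⇔ (∈-succ⁺ ∘ below)
        (λ y∈ → ≤-∈-trans (∈-succ⁻ y∈) β∈m m∈κ)

    -- A least inaccessible point of the relation would have only accessible members, hence be
    -- accessible itself.
    ∈-accessible : ∀ {α} → α ∈ κ → Acc _∈_ α
    ∈-accessible {α} α∈κ = decidable-stable em λ ¬acc →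
      let (m , m∈κ , m-¬acc , m-least) = least (λ x → ¬ Acc _∈_ x) (α , α∈κ , ¬acc)
      in m-¬acc (acc λ {y} y∈m → decidable-stable em λ y-¬acc →
           ≤⇒∌ (m-least (∈-trans y∈m m∈κ) y-¬acc) y∈m)

  ordinal-accessible : ∀ {α} → IsOrdinal α → Acc _∈_ α
  ordinal-accessible ord = acc (∈-accessible ord)

  -- Infinite cardinals are limit ordinals

  SuccClosed : V → Set ℓ
  SuccClosed κ = ∀ {β} → β ∈ κ → succ β ∈ κ

  -- Hilbert's hotel: n + 1 ↦ n, 0 ↦ β, and everything else is fixed.
  succ≈ : ∀ {β} → ω ⊆ β → β ≈ succ β
  succ≈ {β} ω⊆β = graph G total , record
    { function   = graph-isFunction G total
    ; injective  = λ x x′ y p q → injective (∈-graph⁻ G total p) (∈-graph⁻ G total q)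
    ; surjective = surjective
    }
    where
    G : V → V → Set ℓ
    G x y = (¬ (x ∈ ω) × y ≡ x) ⊎ (x ≡ ∅ × y ≡ β) ⊎ (y ∈ ω × x ≡ succ y)

    total : ∀ {x} → x ∈ β → ∃! _≡_ λ y → y ∈ succ β × G x y
    total {x} x∈β with em {x ∈ ω}
    ... | no x∉ω = x , (∈-succ⁺ (inj₁ x∈β) , inj₁ (x∉ω , refl)) , λ where
      (_ , inj₁ (_ , y≡x))          → sym y≡x
      (_ , inj₂ (inj₁ (refl , _)))  → ⊥-elim (x∉ω ∅∈ω)
      (_ , inj₂ (inj₂ (y∈ω , refl))) → ⊥-elim (x∉ω (succ∈ω y∈ω))
    ... | yes x∈ω with ω⊆numerals x∈ω
    ...   | zero , refl = β , (∈-succ , inj₂ (inj₁ (refl , refl))) , λ where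
      (_ , inj₁ (x∉ω , _))          → ⊥-elim (x∉ω x∈ω)
      (_ , inj₂ (inj₁ (_ , y≡β)))   → sym y≡β
      (_ , inj₂ (inj₂ (_ , eq)))    → ⊥-elim (succ≢∅ (sym eq))
    ...   | suc n , refl = numeral n ,
      (∈-succ⁺ (inj₁ (ω⊆β _ (numeral∈ω n))) , inj₂ (inj₂ (numeral∈ω n , refl))) , λ where
      (_ , inj₁ (x∉ω , _))          → ⊥-elim (x∉ω x∈ω)
      (_ , inj₂ (inj₁ (eq , _)))    → ⊥-elim (succ≢∅ eq)
      (_ , inj₂ (inj₂ (_ , eq)))    → succ-injective eq

    injective : ∀ {x x′ y} → x ∈ β × y ∈ succ β × G x y →
                x′ ∈ β × y ∈ succ β × G x′ y → x ≡ x′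
    injective (_ , _ , inj₁ (_ , refl)) (_ , _ , inj₁ (_ , refl)) = refl
    injective (x∈β , _ , inj₁ (_ , refl)) (_ , _ , inj₂ (inj₁ (_ , refl))) = ⊥-elim (∈-irrefl x∈β)
    injective (_ , _ , inj₁ (x∉ω , refl)) (_ , _ , inj₂ (inj₂ (y∈ω , _))) = ⊥-elim (x∉ω y∈ω)
    injective (_ , _ , inj₂ (inj₁ (_ , refl))) (x∈β , _ , inj₁ (_ , refl)) = ⊥-elim (∈-irrefl x∈β)
    injective (_ , _ , inj₂ (inj₁ (refl , _))) (_ , _ , inj₂ (inj₁ (refl , _))) = refl
    injective (_ , _ , inj₂ (inj₁ (_ , refl))) (_ , _ , inj₂ (inj₂ (β∈ω , _))) = ⊥-elim (∈-irrefl (ω⊆β _ β∈ω))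
    injective (_ , _ , inj₂ (inj₂ (y∈ω , _))) (_ , _ , inj₁ (x∉ω , refl)) = ⊥-elim (x∉ω y∈ω)
    injective (_ , _ , inj₂ (inj₂ (β∈ω , _))) (_ , _ , inj₂ (inj₁ (_ , refl))) = ⊥-elim (∈-irrefl (ω⊆β _ β∈ω))
    injective (_ , _ , inj₂ (inj₂ (_ , refl))) (_ , _ , inj₂ (inj₂ (_ , refl))) = refl

    surjective : ∀ y → y ∈ succ β → ∃ λ x → ⟨ x , y ⟩ ∈ graph G total
    surjective y y∈ with ∈-succ⁻ y∈ | em {y ∈ ω}
    ... | inj₂ refl | _       = ∅ , ∈-graph⁺ G total (ω⊆β _ ∅∈ω) y∈ (inj₂ (inj₁ (refl , refl)))
    ... | inj₁ _    | yes y∈ω = succ y , ∈-graph⁺ G total (ω⊆β _ (succ∈ω y∈ω)) y∈ (inj₂ (inj₂ (y∈ω , refl)))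
    ... | inj₁ y∈β  | no y∉ω  = y , ∈-graph⁺ G total y∈β y∈ (inj₁ (y∉ω , refl))

  -- If nothing in `κ` lies above `β`, then `κ` is `succ β`, and `succ≈` makes it equinumerous with
  -- its element `β`.
  infiniteCardinal-succClosed : ∀ {κ} → IsInfiniteCardinal κ → SuccClosed κ
  infiniteCardinal-succClosed {κ} ((ord , initial) , ω≤κ) {β} β∈κ with em {∃ λ x → β ∈ x × x ∈ κ}
  ... | yes (x , β∈x , x∈κ) = ∈⇒succ∈ ord β∈x x∈κ
  ... | no β-max = ⊥-elim (initial β β∈κ (subst (β ≈_) (sym κ≡succ) (succ≈ (ω⊆β ω≤κ))))
    where
    below : ∀ {x} → x ∈ κ → x ≤ β
    below x∈κ = ∉⇒≥ ord β∈κ x∈κ λ β∈x → β-max (_ , β∈x , x∈κ)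

    κ≡succ : κ ≡ succ β
    κ≡succ = extensionality _ _ λ x → mk⇔ (∈-succ⁺ ∘ below) (in-κ ∘ ∈-succ⁻)
      where
      in-κ : ∀ {x} → x ≤ β → x ∈ κ
      in-κ (inj₁ x∈β)  = ∈-trans ord x∈β β∈κ
      in-κ (inj₂ refl) = β∈κ

    ω⊆β : ω ≤ κ → ω ⊆ β
    -- If `κ` were `ω`, then `succ β`, which is `κ`, would be an element of `ω`, that is, of itself.
    ω⊆β (inj₂ refl) = ⊥-elim (∈-irrefl (subst (_∈ κ) (sym κ≡succ) (succ∈ω β∈κ)))
    ω⊆β (inj₁ ω∈κ) with below ω∈κ
    ... | inj₂ refl = λ _ → id
    ... | inj₁ ω∈β  = IsOrdinal.transitive (∈-isOrdinal ord β∈κ) ω ω∈β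

  opaque
    upper-bound : ∀ {κ} → IsInfiniteCardinal κ → ∀ {x y} → x ∈ κ → y ∈ κ →
                  ∃ λ z → z ∈ κ × x ∈ z × y ∈ z
    upper-bound inf@((ord , _) , _) {x} {y} x∈κ y∈κ with IsOrdinal.∈-compare ord x y x∈κ y∈κ
    ... | inj₁ x∈y         = succ y , infiniteCardinal-succClosed inf y∈κ , ∈-succ⁺ (inj₁ x∈y) , ∈-succ
    ... | inj₂ (inj₁ refl) = succ y , infiniteCardinal-succClosed inf y∈κ , ∈-succ , ∈-succ
    ... | inj₂ (inj₂ y∈x)  = succ x , infiniteCardinal-succClosed inf x∈κ , ∈-succ , ∈-succ⁺ (inj₁ y∈x)

  -- Regular cardinals

  module _ {κ : V} (regular : Regular κ) where
    private
      inf = proj₁ regular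
      ord = proj₁ (proj₁ inf)

    opaque
      -- Sending `x` to its least witness defines a function from `α` to `κ` without any choice. By
      -- regularity it is not cofinal, so some `b` exceeds all its values.
      collect : ∀ (R : V → V → Set ℓ) {α} → α ∈ κ →
                (∀ {x} → x ∈ α → ∃ λ y → y ∈ κ × R x y) →
                ∃ λ b → b ∈ κ × (∀ {x} → x ∈ α → ∃ λ y → y ∈ b × R x y)
      collect R {α} α∈κ ∃R = decidable-stable em λ unbounded →
        proj₂ regular α f α∈κ (graph-isFunction Least total) λ β β∈κ →
          decidable-stable em λ ¬cofinal → unbounded (β , β∈κ , λ {x} x∈α →
            let (y , (y∈κ , Rxy , y-least) , _) = total x∈α
            in y , ≰⇒∋ ord β∈κ y∈κ (λ β≤y →
                 ¬cofinal (x , y , ∈-graph⁺ Least total x∈α y∈κ (Rxy , y-least) , β≤y)) , Rxy)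
        where
        Least : V → V → Set ℓ
        Least x y = R x y × (∀ {z} → z ∈ κ → R x z → y ≤ z)

        total : ∀ {x} → x ∈ α → ∃! _≡_ λ y → y ∈ κ × Least x y
        total {x} x∈α =
          let (m , m∈κ , Rxm , m-least) = least ord (R x) (∃R x∈α)
          in m , (m∈κ , Rxm , m-least) , λ (z∈κ , Rxz , z-least) →
               ≤-antisym (m-least z∈κ Rxz) (z-least m∈κ Rxm)
          where
          ≤-antisym : ∀ {m z} → m ≤ z → z ≤ m → m ≡ z
          ≤-antisym (inj₂ m≡z) _          = m≡z
          ≤-antisym (inj₁ _)   (inj₂ z≡m) = sym z≡m
          ≤-antisym (inj₁ m∈z) (inj₁ z∈m) = ⊥-elim (∈-asym m∈z z∈m)

        f : V
        f = graph Least total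

    module _ (ω∈κ : ω ∈ κ) where

      opaque
        -- This is `collect` along `ω`, which is where uncountability of `κ` enters.
        -- `numeral-injective` recovers the index from its numeral.
        collect-ℕ : (R : ℕ → V → Set ℓ) → (∀ n → ∃ λ y → y ∈ κ × R n y) →
                    ∃ λ b → b ∈ κ × (∀ n → ∃ λ y → y ∈ b × R n y)
        collect-ℕ R ∃R =
          let (b , b∈κ , bound) = collect (λ x y → ∀ n → x ≡ numeral n → R n y) ω∈κ λ x∈ω →
                let (n , x≡) = ω⊆numerals x∈ω
                    (y , y∈κ , Rny) = ∃R n
                in y , y∈κ , λ m x≡′ → subst (λ k → R k y) (numeral-injective n m (trans (sym x≡) x≡′)) Rny
          in b , b∈κ , λ n →
            let (y , y∈b , Ry) = bound (numeral∈ω n) in y , y∈b , Ry n refl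

      opaque
        -- Induction on the length: for each head `x` the tails have a common bound, and `collect`
        -- bounds these bounds as `x` varies.
        collect-length : ∀ n (Q : List V → V → Set ℓ) {α} → α ∈ κ →
                         (∀ l → All (_∈ α) l → ∃ λ y → y ∈ κ × Q l y) →
                         ∃ λ b → b ∈ κ × (∀ l → length l ≡ n → All (_∈ α) l → ∃ λ y → y ∈ b × Q l y)
        collect-length zero Q α∈κ ∃Q =
          let (y , y∈κ , Qy) = ∃Q [] []
          in succ y , infiniteCardinal-succClosed inf y∈κ , λ { [] _ _ → y , ∈-succ , Qy }
        collect-length (suc n) Q {α} α∈κ ∃Q =
          let (b , b∈κ , bound) = collect
                (λ x b → ∀ l → length l ≡ n → All (_∈ α) l → ∃ λ y → y ∈ b × Q (x ∷ l) y) α∈κ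
                λ {x} x∈α → collect-length n (λ l → Q (x ∷ l)) α∈κ λ l l∈α → ∃Q (x ∷ l) (x∈α ∷ l∈α)
          in b , b∈κ , λ where
            (x ∷ l) len (x∈α ∷ l∈α) →
              let (c , c∈b , bound′) = bound x∈α
                  (y , y∈c , Qy) = bound′ l (suc-injective len) l∈α
              in y , ≤-∈-trans ord (inj₁ y∈c) c∈b b∈κ , Qy

      opaque
        -- Each length has its own bound, and the countably many bounds have a common one.
        collect-List : (Q : List V → V → Set ℓ) → ∀ {α} → α ∈ κ →
                       (∀ l → All (_∈ α) l → ∃ λ y → y ∈ κ × Q l y) →
                       ∃ λ b → b ∈ κ × (∀ l → All (_∈ α) l → ∃ λ y → y ∈ b × Q l y)
        collect-List Q {α} α∈κ ∃Q =
          let (b , b∈κ , bound) = collect-ℕ _ λ n → collect-length n Q α∈κ ∃Q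
          in b , b∈κ , λ l l∈α →
            let (c , c∈b , bound′) = bound (length l)
                (y , y∈c , Qy) = bound′ l refl l∈α
            in y , ≤-∈-trans ord (inj₁ y∈c) c∈b b∈κ , Qy

  -- Closure points of finitary, possibly many-valued operations

  ClosurePoint : (List V → V → Set ℓ) → V → Set ℓ
  ClosurePoint Q δ = ∀ l → All (_∈ δ) l → ∃ λ y → y ∈ δ × Q l y

  opaque
    bound-list : ∀ {κ} → IsInfiniteCardinal κ → ∀ {x} → x ∈ κ → ∀ {l} → All (_∈ κ) l →
                 ∃ λ b → b ∈ κ × x ∈ b × All (_∈ b) l
    bound-list inf x∈κ [] = succ _ , infiniteCardinal-succClosed inf x∈κ , ∈-succ , []
    bound-list inf@((ord , _) , _) x∈κ (y∈κ ∷ l∈κ) =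
      let (b , b∈κ , x∈b , l∈b) = bound-list inf x∈κ l∈κ
          (c , c∈κ , b∈c , y∈c) = upper-bound inf b∈κ y∈κ
          up = λ {z} (z∈b : z ∈ b) → ≤-∈-trans ord (inj₁ z∈b) b∈c c∈κ
      in c , c∈κ , up x∈b , y∈c ∷ All.map up l∈b

  -- A finite list from `α` already lies in a single closure point below `α`, where it has a value.
  -- For the empty list such a point exists because `α` is nonempty.
  closurePoints-closed : ∀ {Q α} → IsOrdinal α → (∃ λ x → x ∈ α) →
                         LimitOf (ClosurePoint Q) α → ClosurePoint Q α
  closurePoints-closed {Q} {α} ord (x , x∈α) lim l l∈α =
    let (γ , γ∈α , point , l∈γ) = capture l∈α
        (y , y∈γ , Qy) = point l l∈γ
    in y , ∈-trans ord y∈γ γ∈α , Qy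
    where
    capture : ∀ {l} → All (_∈ α) l → ∃ λ γ → γ ∈ α × ClosurePoint Q γ × All (_∈ γ) l
    capture [] = let (γ , γ∈α , _ , point) = lim x x∈α in γ , γ∈α , point , []
    capture (_∷_ {y} y∈α l∈α) with capture l∈α
    ... | γ , γ∈α , point , l∈γ with em {y ∈ γ}
    ... | yes y∈γ = γ , γ∈α , point , y∈γ ∷ l∈γ
    ... | no y∉γ =
      let (δ , δ∈α , y∈δ , point′) = lim y y∈α
          γ∈δ = ≤-∈-trans ord (∉⇒≥ ord y∈α γ∈α y∉γ) y∈δ δ∈α
      in δ , δ∈α , point′ , y∈δ ∷ All.map (λ z∈γ → ≤-∈-trans ord (inj₁ z∈γ) γ∈δ δ∈α) l∈γ

  module _ {κ} (regular : Regular κ) (ω∈κ : ω ∈ κ) where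
    private
      inf = proj₁ regular
      ord = proj₁ (proj₁ inf)

    opaque
      -- Take the least strict upper bound of the sequence. If `x` lies in no `g n`, then `x` is
      -- itself a strict upper bound, since `x ≤ g n` would put `x` in `g (suc n)`; so `x` is not
      -- below the least one.
      ω-supremum : (g : ℕ → V) → (∀ n → g n ∈ κ) → (∀ n → g n ∈ g (suc n)) →
                   ∃ λ γ → γ ∈ κ × (∀ n → g n ∈ γ) × (∀ {x} → x ∈ γ → ∃ λ n → x ∈ g n)
      ω-supremum g g∈κ g-increasing with collect-ℕ regular ω∈κ (λ n y → g n ≡ y) (λ n → g n , g∈κ n , refl)
      ... | b , b∈κ , bound with least ord (λ x → ∀ n → g n ∈ x)
              (b , b∈κ , λ n → let (y , y∈b , eq) = bound n in subst (_∈ b) (sym eq) y∈b)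
      ... | γ , γ∈κ , g∈γ , γ-least = γ , γ∈κ , g∈γ , below
        where
        below : ∀ {x} → x ∈ γ → ∃ λ n → x ∈ g n
        below {x} x∈γ = decidable-stable em λ none →
          ≤⇒∌ (γ-least x∈κ λ n → decidable-stable em λ gn∉x →
            none (suc n , ≤-∈-trans ord (∉⇒≥ ord (g∈κ n) x∈κ gn∉x) (g-increasing n) (g∈κ (suc n)))) x∈γ
          where
          x∈κ : x ∈ κ
          x∈κ = ∈-trans ord x∈γ γ∈κ

    opaque
      collect-next : ∀ {Q} → ClosurePoint Q κ → ∀ {δ} → δ ∈ κ →
                     ∃ λ ε → ε ∈ κ × δ ∈ ε × (∀ l → All (_∈ δ) l → ∃ λ y → y ∈ ε × Q l y)
      collect-next {Q} closed δ∈κ with collect-List regular ω∈κ Q δ∈κ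
        (λ l l∈δ → closed l (All.map (λ x∈δ → ∈-trans ord x∈δ δ∈κ) l∈δ))
      ... | b , b∈κ , bound with upper-bound inf δ∈κ b∈κ
      ... | ε , ε∈κ , δ∈ε , b∈ε = ε , ε∈κ , δ∈ε , λ l l∈δ →
        let (y , y∈b , Qy) = bound l l∈δ in y , ≤-∈-trans ord (inj₁ y∈b) b∈ε ε∈κ , Qy

    -- A finite list below the supremum lies below one stage `g n`, and its values appear by stage
    -- `suc n`.
    ω-supremum-closurePoint :
      ∀ {Q} {g : ℕ → V} → (∀ n → g n ∈ κ) →
      (∀ n l → All (_∈ g n) l → ∃ λ y → y ∈ g (suc n) × Q l y) →
      ∀ {γ} → γ ∈ κ → (∀ n → g n ∈ γ) → (∀ {x} → x ∈ γ → ∃ λ n → x ∈ g n) → ClosurePoint Q γ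
    ω-supremum-closurePoint {Q} {g} g∈κ g-closed {γ} γ∈κ g∈γ below l l∈γ =
      let (n , l∈gn) = capture l∈γ
          (y , y∈ , Qy) = g-closed n l l∈gn
      in y , ≤-∈-trans ord (inj₁ y∈) (g∈γ (suc n)) γ∈κ , Qy
      where
      capture : ∀ {l} → All (_∈ γ) l → ∃ λ n → All (_∈ g n) l
      capture [] = 0 , []
      capture (_∷_ {x} x∈γ l∈γ) with capture l∈γ | below x∈γ
      ... | m , l∈gm | n , x∈gn with IsOrdinal.∈-compare ord (g m) (g n) (g∈κ m) (g∈κ n)
      ... | inj₁ gm∈gn = n , x∈gn ∷ All.map (λ z∈ → ≤-∈-trans ord (inj₁ z∈) gm∈gn (g∈κ n)) l∈gm
      ... | inj₂ (inj₁ gm≡gn) = m , subst (x ∈_) (sym gm≡gn) x∈gn ∷ l∈gm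
      ... | inj₂ (inj₂ gn∈gm) = m , ≤-∈-trans ord (inj₁ x∈gn) gn∈gm (g∈κ m) ∷ l∈gm

    -- Starting from `β`, repeat `collect-next` countably often and take the supremum of the stages.
    closurePoints-unbounded : ∀ {Q} → ClosurePoint Q κ → LimitOf (ClosurePoint Q) κ
    closurePoints-unbounded {Q} closed β β∈κ = iterate (collect-next closed)
      where
      iterate : (∀ {δ} → δ ∈ κ → ∃ λ ε → ε ∈ κ × δ ∈ ε × (∀ l → All (_∈ δ) l → ∃ λ y → y ∈ ε × Q l y)) →
                ∃ λ γ → γ ∈ κ × β ∈ γ × ClosurePoint Q γ
      iterate step = let (γ , γ∈κ , g∈γ , below) = ω-supremum g g∈κ g-increasing in
        γ , γ∈κ , g∈γ 0 ,
        ω-supremum-closurePoint {Q} {g} g∈κ (λ n → proj₂ (proj₂ (proj₂ (step (g∈κ n))))) γ∈κ g∈γ below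
        where
        stage : ℕ → ∃ λ δ → δ ∈ κ
        stage zero    = β , β∈κ
        stage (suc n) = let (ε , ε∈κ , _) = step (proj₂ (stage n)) in ε , ε∈κ

        g : ℕ → V
        g = proj₁ ∘ stage

        g∈κ : ∀ n → g n ∈ κ
        g∈κ = proj₂ ∘ stage

        g-increasing : ∀ n → g n ∈ g (suc n)
        g-increasing n = proj₁ (proj₂ (proj₂ (step (g∈κ n))))

  -- Meta-ordinal terms

  _≺ₗ_ : List (V × V) → List (V × V) → Set ℓ
  _≺ₗ_ = Lex-< _≡_ (×-Lex _≡_ _∈_ _∈_)

  record IsTerm (l : List (V × V)) : Set ℓ where
    constructor isTerm
    field
      ordinals′   : All (λ (α , β) → IsOrdinal α × IsOrdinal β) l
      decreasing′ : Linked (λ (α , _) (η , _) → η ∈ α) l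

  -- These are the terms of degree less than `α`, the possible tails after a summand with exponent
  -- `α`.
  data DegreeBelow (α : V) : List (V × V) → Set ℓ where
    []  : DegreeBelow α []
    _∷_ : ∀ {η β l} → η ∈ α → IsTerm ((η , β) ∷ l) → DegreeBelow α ((η , β) ∷ l)

  _≺ₜ_ : List (V × V) → List (V × V) → Set ℓ
  k ≺ₜ l = IsTerm k × k ≺ₗ l

  term-tail : ∀ {α β l} → IsTerm ((α , β) ∷ l) → DegreeBelow α l
  term-tail {l = []}    _ = []
  term-tail {l = _ ∷ _} (isTerm (_ ∷ os) (η∈α ∷ ds)) = η∈α ∷ isTerm os ds

  -- Nested induction on the leading exponent, its coefficient and the tail. A smaller term lowers
  -- the first of these at which it differs. The lexicographic order on arbitrary lists is not
  -- well-founded; decreasing exponents save the argument by keeping every tail of smaller degree.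
  degreeBelow-accessible : ∀ {α} → Acc _∈_ α → ∀ {l} → DegreeBelow α l → Acc _≺ₜ_ l
  leading-accessible : ∀ {α β l} → Acc _∈_ α → Acc _∈_ β → Acc _≺ₜ_ l → Acc _≺ₜ_ ((α , β) ∷ l)

  ≺-leading-accessible : ∀ {α β l k} → Acc _∈_ α → Acc _∈_ β → Acc _≺ₜ_ l →
                         k ≺ₜ ((α , β) ∷ l) → Acc _≺ₜ_ k

  degreeBelow-accessible _ [] = acc λ { (_ , base ()) }
  degreeBelow-accessible (acc rs) (η∈α ∷ t@(isTerm ((_ , β-ord) ∷ _) _)) =
    leading-accessible (rs η∈α) (ordinal-accessible β-ord) (degreeBelow-accessible (rs η∈α) (term-tail t))

  leading-accessible α-acc β-acc l-acc = acc (≺-leading-accessible α-acc β-acc l-acc)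

  ≺-leading-accessible {k = []} _ _ _ _ = acc λ { (_ , base ()) }
  ≺-leading-accessible {k = _ ∷ _} α-acc _ _ (t , this (inj₁ η∈α)) =
    degreeBelow-accessible α-acc (η∈α ∷ t)
  -- When the coefficient drops, the new tail is arbitrary, but its degree is below `α`, so it is
  -- accessible.
  ≺-leading-accessible {k = _ ∷ _} α-acc (acc β-rs) _ (t , this (inj₂ (refl , γ∈β))) =
    leading-accessible α-acc (β-rs γ∈β) (degreeBelow-accessible α-acc (term-tail t))
  ≺-leading-accessible {k = _ ∷ _} α-acc β-acc (acc l-rs) (isTerm (_ ∷ os) ds , next refl k≺l) =
    leading-accessible α-acc β-acc (l-rs (isTerm os (Linked.tail ds) , k≺l))

  term-accessible : ∀ {l} → IsTerm l → Acc _≺ₜ_ l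
  term-accessible {[]} _ = acc λ { (_ , base ()) }
  term-accessible {_ ∷ _} t@(isTerm ((α-ord , β-ord) ∷ _) _) =
    leading-accessible (ordinal-accessible α-ord) (ordinal-accessible β-ord)
      (degreeBelow-accessible (ordinal-accessible α-ord) (term-tail t))

  summands-isTerm : ∀ t → IsTerm (summands t)
  summands-isTerm t = isTerm (ordinals t) (decreasing t)

  -- Flattening lets a term serve as argument of an operation on finite lists of sets.
  entries : List (V × V) → List V
  entries []            = []
  entries ((α , β) ∷ l) = α ∷ β ∷ entries l

  entries-injective : ∀ k l → entries k ≡ entries l → k ≡ l
  entries-injective []            []            _  = refl
  entries-injective ((α , β) ∷ k) ((α′ , β′) ∷ l) eq with ∷-injective eq
  ... | refl , eq′ with ∷-injective eq′
  ... | refl , eq″ = cong ((α , β) ∷_) (entries-injective k l eq″)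

  entries⁺ : ∀ {κ l} → All (λ (α , β) → α ∈ κ × β ∈ κ) l → All (_∈ κ) (entries l)
  entries⁺ []                  = []
  entries⁺ ((α∈ , β∈) ∷ below) = α∈ ∷ β∈ ∷ entries⁺ below

  entries⁻ : ∀ {κ} l → All (_∈ κ) (entries l) → All (λ (α , β) → α ∈ κ × β ∈ κ) l
  entries⁻ []      []               = []
  entries⁻ (_ ∷ l) (α∈ ∷ β∈ ∷ below) = (α∈ , β∈) ∷ entries⁻ l below

  -- Terms with equal summands may still differ in their proof components, and `entries` determines
  -- only the summands.
  inaccessible-cong : ∀ {s t κ} → summands s ≡ summands t → s -inaccessible κ → t -inaccessible κ
  inaccessible-cong eq (inaccessible below inacc lim) = inaccessible
    (subst (All _) eq below) inacc
    λ r r≺t → lim r (subst (summands r ≺ₗ_) (sym eq) r≺t)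

  -- Mahlo cardinals

  module _ {κ : V} (mahlo : Mahlo κ) where
    private
      inf = proj₁ mahlo
      ord = proj₁ (proj₁ inf)

    opaque
      -- Stationarity, applied to the club that `P` cuts out of `κ`.
      reflect : (P : V → Set ℓ) →
                (∀ {α} → α ∈ κ → (∃ λ x → x ∈ α) → LimitOf P α → P α) → LimitOf P κ →
                ∃ λ γ → γ ∈ κ × Inaccessible γ × P γ
      reflect P closed unbounded =
        let (γ , γ∈inacc , γ∈club) = proj₂ (proj₂ mahlo) (sep P κ)
              ( (λ _ → proj₁ ∘ ∈-sep⁻)
              , (λ α α∈κ α≢∅ unb → ∈-sep⁺ α∈κ (closed α∈κ (≢∅⇒nonempty α≢∅) λ β β∈α →
                  let (δ , δ∈α , β∈δ , δ∈club) = unb β β∈α in δ , δ∈α , β∈δ , proj₂ (∈-sep⁻ δ∈club)))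
              , λ β β∈κ →
                  let (δ , δ∈κ , β∈δ , Pδ) = unbounded β β∈κ in δ , δ∈κ , β∈δ , ∈-sep⁺ δ∈κ Pδ)
            (γ∈κ , inacc) = ∈-sep⁻ γ∈inacc
        in γ , γ∈κ , inacc , proj₂ (∈-sep⁻ γ∈club)

    ∈-closed : ∀ {μ α} → α ∈ κ → (∃ λ x → x ∈ α) → LimitOf (μ ∈_) α → μ ∈ α
    ∈-closed α∈κ (x , x∈α) lim =
      let (_ , γ∈α , _ , μ∈γ) = lim x x∈α in ≤-∈-trans ord (inj₁ μ∈γ) γ∈α α∈κ

    -- The elements of `κ` above `β` form a club.
    inaccessibles-unbounded : LimitOf Inaccessible κ
    inaccessibles-unbounded β β∈κ =
      let (γ , γ∈κ , inacc , β∈γ) = reflect (β ∈_) ∈-closed λ x x∈κ →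
            let (z , z∈κ , x∈z , β∈z) = upper-bound inf x∈κ β∈κ in z , z∈κ , x∈z , β∈z
      in γ , γ∈κ , β∈γ , inacc

    ∅∈κ : ω ≤ κ → ∅ ∈ κ
    ∅∈κ (inj₁ ω∈κ)  = ∈-trans ord ∅∈ω ω∈κ
    ∅∈κ (inj₂ refl) = ∅∈ω

    mahlo-uncountable : ω ∈ κ
    mahlo-uncountable =
      let (_ , γ∈κ , _ , ω∈γ , _) = inaccessibles-unbounded ∅ (∅∈κ (proj₂ inf)) in ∈-trans ord ω∈γ γ∈κ

    opaque
      -- At a regular `γ` above `α`, the values of `f` lying in `γ` are bounded in `γ` by `collect`,
      -- so they cannot be cofinal there.
      mahlo-regular : Regular κ
      mahlo-regular = inf , λ α f α∈κ f-fun cofinal →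
        let CofinalIn : V → Set ℓ
            CofinalIn γ = ∀ β → β ∈ γ → ∃ λ ξ → ∃ λ η → (ξ ∈ α × ⟨ ξ , η ⟩ ∈ f) × η ∈ γ × β ≤ η

            in-range : ∀ {ξ η} → ⟨ ξ , η ⟩ ∈ f → ξ ∈ α × η ∈ κ
            in-range p = let (x , y , x∈α , y∈κ , eq) = IsFunction.graph f-fun _ p in
              subst (_∈ α) (sym (⟨,⟩-injectiveˡ eq)) x∈α , subst (_∈ κ) (sym (⟨,⟩-injectiveʳ eq)) y∈κ

            (γ , γ∈κ , (_ , γ-regular , _) , α∈γ , γ-cofinal) =
              reflect (λ γ → α ∈ γ × CofinalIn γ)
                (λ {δ} δ∈κ δ-nonempty lim →
                  ∈-closed δ∈κ δ-nonempty (λ β β∈δ →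
                    let (γ , γ∈δ , β∈γ , α∈γ , _) = lim β β∈δ in γ , γ∈δ , β∈γ , α∈γ) ,
                  λ β β∈δ →
                    let (γ , γ∈δ , β∈γ , _ , cof) = lim β β∈δ
                        (ξ , η , p , η∈γ , β≤η) = cof β β∈γ
                    in ξ , η , p , ≤-∈-trans ord (inj₁ η∈γ) γ∈δ δ∈κ , β≤η)
                -- For unboundedness take a value `η` of `f` at or above a common bound `z` of `α`
                -- and `β`. In `succ η` the values of `f` are trivially cofinal, because `η` is its
                -- largest element.
                (λ β β∈κ →
                  let (z , z∈κ , α∈z , β∈z) = upper-bound inf α∈κ β∈κ
                      (ξ , η , p , z≤η) = cofinal z z∈κ
                      (ξ∈α , η∈κ) = in-range p
                      sη∈κ = infiniteCardinal-succClosed inf η∈κ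
                      z∈sη = ∈-succ⁺ z≤η
                  in succ η , sη∈κ , ≤-∈-trans ord (inj₁ β∈z) z∈sη sη∈κ ,
                     ≤-∈-trans ord (inj₁ α∈z) z∈sη sη∈κ ,
                     λ δ δ∈sη → ξ , η , (ξ∈α , p) , ∈-succ , ∈-succ⁻ δ∈sη)

            -- Values of `f` may fall outside `γ`, so the collected relation constrains only those
            -- inside it.
            (b , b∈γ , bound) = collect γ-regular
              (λ x y → ∀ z → z ∈ γ → ⟨ x , z ⟩ ∈ f → z ≡ y) α∈γ λ {x} x∈α →
                let (y , _ , unique) = IsFunction.total f-fun x x∈α in
                default em unique α∈γ

            -- Cofinality at `b` gives a value `η ≥ b` in `γ`, while `bound` puts that same value in
            -- `b`.
            (ξ , η , (ξ∈α , p) , η∈γ , b≤η) = γ-cofinal b b∈γ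
            (y , y∈b , y-value) = bound ξ∈α
            b∈b = ≤-∈-trans (proj₁ (proj₁ (proj₁ γ-regular))) b≤η
                    (subst (_∈ b) (sym (y-value η η∈γ p)) y∈b) b∈γ
        in ∈-irrefl b∈b
        where
        -- If the value `y` is outside `γ`, the requirement is vacuous, and `α` serves as a dummy
        -- element of `γ`.
        default : ∀ {γ y α} {P : V → Set ℓ} → Dec (y ∈ γ) → (∀ {z} → P z → y ≡ z) → α ∈ γ →
                  ∃ λ y′ → y′ ∈ γ × (∀ z → z ∈ γ → P z → z ≡ y′)
        default (yes y∈γ) unique _ = _ , y∈γ , λ z _ Pz → sym (unique Pz)
        default {γ} (no y∉γ) unique α∈γ =
          _ , α∈γ , λ z z∈γ Pz → ⊥-elim (y∉γ (subst (_∈ γ) (sym (unique Pz)) z∈γ))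

    -- For the strong limit property, choose an inaccessible `γ` with `μ ∈ γ ∈ κ`; the power `2^μ`
    -- is already below `γ`.
    mahlo-inaccessible : Inaccessible κ
    mahlo-inaccessible = mahlo-uncountable , mahlo-regular , λ μ μ∈κ μ-card →
      let (γ , γ∈κ , μ∈γ , _ , _ , strongLimit) = inaccessibles-unbounded μ μ∈κ
          (ν , ν∈γ , ν-card , ν≈𝒫μ) = strongLimit μ μ∈γ μ-card
      in ν , ∈-trans ord ν∈γ γ∈κ , ν-card , ν≈𝒫μ

    limit-step : ∀ s → (∀ r → r ≺ s → r Below κ → LimitOf (r -inaccessible_) κ) →
                 s Below κ → LimitOf (s -inaccessible_) κ
    limit-step s ih s<κ β β∈κ =
      γ , γ∈κ , up β∈b , inaccessible (entries⁻ (summands s) (All.map up s<b)) inacc λ r r≺s r<γ ζ ζ∈γ →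
        -- Evaluating the closure point at `ζ` followed by the ordinals of `r` returns an
        -- `r`-inaccessible cardinal above `ζ` and below `γ`.
        let (y , y∈γ , _ , l∈y , r-inacc) = point (ζ ∷ entries (summands r)) (ζ∈γ ∷ entries⁺ r<γ)
        in y , y∈γ , All.head l∈y , r-inacc r ζ r≺s refl
      where
      -- `b` exceeds `β` and all ordinals of `s`. Building `b ∈ γ` into `Q` forces every closure
      -- point above them.
      bound = bound-list inf β∈κ (entries⁺ s<κ)
      b     = proj₁ bound
      b∈κ   = proj₁ (proj₂ bound)
      β∈b   = proj₁ (proj₂ (proj₂ bound))
      s<b   = proj₂ (proj₂ (proj₂ bound))

      -- The operations r , ζ ↦ some r-inaccessible cardinal above ζ, for r ≺ s.
      Q : List V → V → Set ℓ
      Q l γ = b ∈ γ × All (_∈ γ) l ×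
        (∀ r ζ → r ≺ s → l ≡ ζ ∷ entries (summands r) → r -inaccessible γ)

      closed : ClosurePoint Q κ
      closed l l∈κ with bound-list inf b∈κ l∈κ
                      | em {∃ λ r → ∃ λ ζ → r ≺ s × l ≡ ζ ∷ entries (summands r)}
      -- A list that codes no pair of `ζ` and `r ≺ s` satisfies the last clause vacuously, so any
      -- large enough `c` is a value.
      closed l l∈κ | c , c∈κ , b∈c , l∈c | no none =
        c , c∈κ , b∈c , l∈c , λ r ζ r≺s eq → ⊥-elim (none (r , ζ , r≺s , eq))
      -- Applying the induction hypothesis above `c`, which bounds `b` and the whole list, secures
      -- the first two clauses as well.
      closed _ (_ ∷ r∈κ) | c , c∈κ , b∈c , l∈c | yes (r , _ , r≺s , refl) =
        let (γ , γ∈κ , c∈γ , r-inacc) = ih r r≺s (entries⁻ (summands r) r∈κ) c c∈κ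
            lift = λ {z} (z∈c : z ∈ c) → ≤-∈-trans ord (inj₁ z∈c) c∈γ γ∈κ
        in γ , γ∈κ , lift b∈c , All.map lift l∈c , λ _ _ _ eq →
             inaccessible-cong (entries-injective _ _ (proj₂ (∷-injective eq))) r-inacc

      reflected = reflect (ClosurePoint Q)
        (λ α∈κ → closurePoints-closed (∈-isOrdinal ord α∈κ))
        (closurePoints-unbounded mahlo-regular mahlo-uncountable closed)
      γ     = proj₁ reflected
      γ∈κ   = proj₁ (proj₂ reflected)
      inacc = proj₁ (proj₂ (proj₂ reflected))
      point = proj₂ (proj₂ (proj₂ reflected))

      -- Even the empty list has a value in `γ`, and that value lies above `b`.
      b∈γ : b ∈ γ
      b∈γ = let (y , y∈γ , b∈y , _) = point [] [] in ≤-∈-trans ord (inj₁ b∈y) y∈γ γ∈κ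

      up : ∀ {z} → z ∈ b → z ∈ γ
      up z∈b = ≤-∈-trans ord (inj₁ z∈b) b∈γ γ∈κ

    limit-of-inaccessibles : ∀ s → Acc _≺ₜ_ (summands s) → s Below κ → LimitOf (s -inaccessible_) κ
    limit-of-inaccessibles s (acc rs) = limit-step s λ r r≺s →
      limit-of-inaccessibles r (rs (summands-isTerm r , r≺s))

theorem11 : ∀ {ℓ} → ExcludedMiddle ℓ → (𝕍 : ZFC ℓ) → let open SetTheory 𝕍 in
    ∀ κ → Mahlo κ → ∀ t → t Below κ → t -inaccessible κ
theorem11 em 𝕍 κ mahlo t t<κ = SetTheory.inaccessible t<κ (mahlo-inaccessible em 𝕍 mahlo) λ s s≺t s<κ →
  limit-of-inaccessibles em 𝕍 mahlo s (term-accessible em 𝕍 (summands-isTerm em 𝕍 s)) s<κ
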